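{- Define sequences of primes as follows. For a prime $a$, let $S(a)=(s(1),s(2),\dots)$ be the sequence with $s(1)=a$ and, for $j\ge 2$, $s(j)$ the largest prime less than $2s(j-1)$. Put $p^{(1)}=2$ and $B_1=S(2)$; inductively, for $k\ge 2$, let $p^{(k)}$ be the smallest prime not belonging to $B_1\cup\dots\cup B_{k-1}$, and put $B_k=S(p^{(k)})$. Call a prime $p$ an RPR-prime if, with $q$ the smallest prime greater than $p/2$, the open interval $(p,2q)$ contains a prime; let $(RPR)_n$ denote the $n$-th RPR-prime in increasing order. Then for every $n\ge 1$, $p^{(n)}=(RPR)_n$.
   Context: Equivalently (for odd $p=p_n$, $p_k$ the $k$-th prime), $p$ is an RPR-prime iff all integers $\frac{p+1}{2},\frac{p+3}{2},\dots,\frac{p_{n+1}-1}{2}$ are composite. The first RPR-primes are $2,11,17,29,41,47,59,67,71,97,101,107,109,127,\dots$. -}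

module Defs where

open import Data.Nat using (ℕ; zero; suc; _*_; _≤_; _<_; >-nonZero⁻¹)
open import Data.Nat.Primality using (Prime; prime?; prime⇒nonZero)
open import Data.Nat.Properties using (≤-refl; ≤-pred; m≤n⇒m≤1+n; m≤n⇒m<n∨m≡n; m<m+n; +-identityʳ)
open import Data.Product using (∃-syntax; _×_; _,_; proj₁)
open import Data.Sum using (inj₁; inj₂)
open import Relation.Nullary using (¬_; yes; no; contradiction)
open import Relation.Binary.PropositionalEquality using (_≡_; refl; sym; subst)

IsLeast : (ℕ → Set) → ℕ → Set
IsLeast P x = P x × (∀ y → P y → x ≤ y)

IsGreatest : (ℕ → Set) → ℕ → Set
IsGreatest P x = P x × (∀ y → P y → y ≤ x)

PrimeBelow : ℕ → ℕ → Set
PrimeBelow n q = Prime q × q < n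

-- Takes the junk value 0 when n ≤ 2, i.e. when no prime is less than n.
largestPrimeBelow : ℕ → ℕ
largestPrimeBelow zero = 0
largestPrimeBelow (suc n) with prime? n
... | yes _ = n
... | no _ = largestPrimeBelow n

private
  shrink : ∀ {n q} → ¬ Prime n → PrimeBelow (suc n) q → PrimeBelow n q
  shrink ¬pn (pq , q<1+n) with m≤n⇒m<n∨m≡n (≤-pred q<1+n)
  ... | inj₁ q<n = pq , q<n
  ... | inj₂ refl = contradiction pq ¬pn

  prime⇒<2* : ∀ {a} → Prime a → a < 2 * a
  prime⇒<2* {a} pa = m<m+n a (subst (0 <_) (sym (+-identityʳ a)) (>-nonZero⁻¹ a {{prime⇒nonZero pa}}))

largestPrimeBelow-isGreatest : ∀ n q → PrimeBelow n q → IsGreatest (PrimeBelow n) (largestPrimeBelow n)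
largestPrimeBelow-isGreatest (suc n) q b with prime? n
... | yes pn = (pn , ≤-refl) , λ { y (_ , y<1+n) → ≤-pred y<1+n }
... | no ¬pn with largestPrimeBelow-isGreatest n q (shrink ¬pn b)
...   | (pm , m<n) , max = (pm , m≤n⇒m≤1+n m<n) , λ y c → max y (shrink ¬pn c)

-- S a j is the term s(j) of the sequence S(a); terms are numbered from 1,
-- and the value at index 0 is never used.
S : ℕ → ℕ → ℕ
S a 0 = 0
S a 1 = a
S a (suc (suc j)) = largestPrimeBelow (2 * S a (suc j))

-- For prime a the junk value of largestPrimeBelow never occurs in S(a).
S-prime : ∀ {a} → Prime a → ∀ j → Prime (S a (suc j))
S-step : ∀ {a} → Prime a → ∀ j → IsGreatest (PrimeBelow (2 * S a (suc j))) (S a (suc (suc j)))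
S-prime pa zero = pa
S-prime pa (suc j) = proj₁ (proj₁ (S-step pa j))
S-step {a} pa j = largestPrimeBelow-isGreatest _ (S a (suc j)) (S-prime pa j , prime⇒<2* (S-prime pa j))

_∈S_ : ℕ → ℕ → Set
x ∈S a = ∃[ j ] (1 ≤ j × S a j ≡ x)

-- p k stands for p^(k), with k ≥ 1, and the block B_i is S(p i); p 0 is unconstrained.
IsBlockStartSequence : (ℕ → ℕ) → Set
IsBlockStartSequence p =
  p 1 ≡ 2 ×
  (∀ k → 2 ≤ k →
    IsLeast (λ q → Prime q × ¬ (∃[ i ] (1 ≤ i × i < k × q ∈S p i))) (p k))

-- The condition q > p/2 is written p < 2 * q.
IsRPR : ℕ → Set
IsRPR p =
  Prime p ×
  ∃[ q ] (IsLeast (λ q′ → Prime q′ × p < 2 * q′) q ×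
          ∃[ t ] (Prime t × p < t × t < 2 * q))

-- r n is the n-th RPR-prime in increasing order, with n ≥ 1; r 0 is unconstrained.
IsRPREnumeration : (ℕ → ℕ) → Set
IsRPREnumeration r =
  (∀ n → 1 ≤ n → IsRPR (r n)) ×
  (∀ m n → 1 ≤ m → m < n → r m < r n) ×
  (∀ x → IsRPR x → ∃[ n ] (1 ≤ n × r n ≡ x))

{-# OPTIONS --safe #-}
module Submission where

-- Write f(a) for the largest prime below 2a. A prime is RPR iff it is not a value of f at a prime, so
-- RPR-primes can only occur in a block as its first term. If every non-RPR prime x is f(q) for a prime
-- q < x, going back from x leads to an RPR-prime, so the blocks started at RPR-primes exhaust the primes
-- and the greedy choice of starts picks the RPR-primes in order. Two facts about primes are needed.
--
-- (1) A prime x is never the only prime in (x/2, 2x); otherwise f(x) = x would be its only preimage.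
-- (2) There are infinitely many RPR-primes. Otherwise a number 2q lies between any two consecutive large
--     primes, so π(y) - π(y/2) is bounded and π(2^k) = O(k).
--
-- Both follow from one estimate: if X is a common multiple of 1, …, n+1, then (n+1) C(n,k) divides X
-- for every k ≤ n, and summing over k gives 2^n ≤ X. Apply it to X = ∏ maxPower N p over the primes
-- p ≤ N = n+1: for (2), X ≤ N^π(N); for (1), X ≤ N^(√N+1) · primorial(x/2) with N = 2x, where
-- primorial(m) ≤ 4^m.

open import Defs
open import Data.List using ([]; _∷_)
open import Data.List.Relation.Unary.All using (_∷_)
open import Data.Nat
open import Data.Nat.Combinatorics using (_C_; nCk+nC[k+1]≡[n+1]C[k+1]; nC1≡n; k>n⇒nCk≡0; nCk≡n!/k![n-k]!; k![n∸k]!∣n!)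
open import Data.Nat.DivMod using (m/n*n≡m)
open import Data.Nat.Divisibility
open import Data.Nat.Induction using (<-rec)
open import Data.Nat.Primality
open import Data.Nat.Primality.Factorisation using (factorise)
open import Data.Nat.Properties
open import Data.Nat.Tactic.RingSolver using (solve-∀)
open import Data.Product using (∃-syntax; _×_; _,_; proj₁; proj₂)
open import Data.Sum using (_⊎_; inj₁; inj₂; [_,_]′)
open import Function using (id)
open import Relation.Binary.Definitions using (tri<; tri≈; tri>)
open import Relation.Binary.PropositionalEquality
open import Relation.Nullary using (¬_; yes; no; contradiction)
open import Relation.Nullary.Decidable using (True; toWitness; _×-dec_; ¬?)
open import Relation.Unary using (Decidable)

-- Common multiples of 1, …, N

[k+1]*[n+1]C[k+1]≡[n+1]*nCk : ∀ n k → suc k * (suc n C suc k) ≡ suc n * (n C k)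
[k+1]*[n+1]C[k+1]≡[n+1]*nCk zero zero = refl
[k+1]*[n+1]C[k+1]≡[n+1]*nCk zero (suc k) = *-zeroʳ (2 + k)
[k+1]*[n+1]C[k+1]≡[n+1]*nCk (suc n) zero = begin
  1 * ((2 + n) C 1)    ≡⟨ *-identityˡ _ ⟩
  (2 + n) C 1          ≡⟨ nC1≡n (2 + n) ⟩
  2 + n                ≡⟨ *-identityʳ (2 + n) ⟨
  (2 + n) * 1          ∎
  where open ≡-Reasoning
[k+1]*[n+1]C[k+1]≡[n+1]*nCk (suc n) (suc k) = begin
  (2 + k) * ((2 + n) C (2 + k))
    ≡⟨ cong ((2 + k) *_) (nCk+nC[k+1]≡[n+1]C[k+1] (suc n) (suc k)) ⟨
  (2 + k) * (a + b)
    ≡⟨ split k a b ⟩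
  a + (suc k * a + (2 + k) * b)
    ≡⟨ cong (a +_) (cong₂ _+_ ([k+1]*[n+1]C[k+1]≡[n+1]*nCk n k) ([k+1]*[n+1]C[k+1]≡[n+1]*nCk n (suc k))) ⟩
  a + (suc n * (n C k) + suc n * (n C suc k))
    ≡⟨ cong (a +_) (*-distribˡ-+ (suc n) (n C k) (n C suc k)) ⟨
  a + suc n * (n C k + n C suc k)
    ≡⟨ cong (λ c → a + suc n * c) (nCk+nC[k+1]≡[n+1]C[k+1] n k) ⟩
  (2 + n) * a ∎
  where
  open ≡-Reasoning
  a = suc n C suc k
  b = suc n C (2 + k)
  split : ∀ k a b → (2 + k) * (a + b) ≡ a + (suc k * a + (2 + k) * b)
  split = solve-∀

-- A subtraction-free form of (n+1-k) C(n+1,k) = (n+1) C(n,k).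
[n+1]*[n+1]Ck≡[n+1]*nCk+k*[n+1]Ck : ∀ n k → suc n * (suc n C k) ≡ suc n * (n C k) + k * (suc n C k)
[n+1]*[n+1]Ck≡[n+1]*nCk+k*[n+1]Ck n zero = sym (+-identityʳ _)
[n+1]*[n+1]Ck≡[n+1]*nCk+k*[n+1]Ck n (suc k) = begin
  suc n * (suc n C suc k)                       ≡⟨ cong (suc n *_) (nCk+nC[k+1]≡[n+1]C[k+1] n k) ⟨
  suc n * (n C k + n C suc k)                   ≡⟨ cong (suc n *_) (+-comm (n C k) _) ⟩
  suc n * (n C suc k + n C k)                   ≡⟨ *-distribˡ-+ (suc n) (n C suc k) _ ⟩
  suc n * (n C suc k) + suc n * (n C k)         ≡⟨ cong (suc n * (n C suc k) +_) ([k+1]*[n+1]C[k+1]≡[n+1]*nCk n k) ⟨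
  suc n * (n C suc k) + suc k * (suc n C suc k) ∎
  where open ≡-Reasoning

-- By Pascal's rule an adjacent pair is the sum of two adjacent pairs of the previous row, so the
-- bound doubles from row to row. It yields C(2m+1,m) ≤ 4^m.
nCk+nC[k+1]≤2^n : ∀ n k → n C k + n C suc k ≤ 2 ^ n
nCk+nC[k+1]≤2^n zero zero = ≤-refl
nCk+nC[k+1]≤2^n zero (suc k) = z≤n
nCk+nC[k+1]≤2^n (suc n) zero = begin
  1 + suc n C 1      ≡⟨ cong suc (nC1≡n (suc n)) ⟩
  2 + n              ≡⟨ cong suc (cong suc (nC1≡n n)) ⟨
  1 + (1 + n C 1)    ≤⟨ +-mono-≤ (m^n>0 2 n) (nCk+nC[k+1]≤2^n n 0) ⟩
  2 ^ n + 2 ^ n      ≡⟨ cong (2 ^ n +_) (+-identityʳ (2 ^ n)) ⟨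
  2 ^ suc n          ∎
  where open ≤-Reasoning
nCk+nC[k+1]≤2^n (suc n) (suc k) = begin
  suc n C suc k + suc n C (2 + k)
    ≡⟨ cong₂ _+_ (nCk+nC[k+1]≡[n+1]C[k+1] n k) (nCk+nC[k+1]≡[n+1]C[k+1] n (suc k)) ⟨
  (n C k + n C suc k) + (n C suc k + n C (2 + k))
    ≤⟨ +-mono-≤ (nCk+nC[k+1]≤2^n n k) (nCk+nC[k+1]≤2^n n (suc k)) ⟩
  2 ^ n + 2 ^ n
    ≡⟨ cong (2 ^ n +_) (+-identityʳ (2 ^ n)) ⟨
  2 ^ suc n ∎
  where open ≤-Reasoning

rowSum : ℕ → ℕ → ℕ
rowSum n zero = 0
rowSum n (suc m) = n C m + rowSum n m

rowSum-suc : ∀ n m → rowSum (suc n) (suc m) ≡ rowSum n (suc m) + rowSum n m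
rowSum-suc n zero = refl
rowSum-suc n (suc m) = begin
  suc n C suc m + rowSum (suc n) (suc m)
    ≡⟨ cong₂ _+_ (sym (nCk+nC[k+1]≡[n+1]C[k+1] n m)) (rowSum-suc n m) ⟩
  (n C m + n C suc m) + ((n C m + rowSum n m) + rowSum n m)
    ≡⟨ rearrange (n C m) (n C suc m) (rowSum n m) ⟩
  rowSum n (2 + m) + rowSum n (suc m) ∎
  where
  open ≡-Reasoning
  rearrange : ∀ a b s → (a + b) + ((a + s) + s) ≡ (b + (a + s)) + (a + s)
  rearrange = solve-∀

rowSum≡2^n : ∀ n → rowSum n (suc n) ≡ 2 ^ n
rowSum≡2^n zero = refl
rowSum≡2^n (suc n) = begin
  rowSum (suc n) (2 + n)                              ≡⟨ rowSum-suc n (suc n) ⟩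
  (n C suc n + rowSum n (suc n)) + rowSum n (suc n)   ≡⟨ cong (λ c → (c + rowSum n (suc n)) + rowSum n (suc n)) (k>n⇒nCk≡0 (n<1+n n)) ⟩
  rowSum n (suc n) + rowSum n (suc n)                 ≡⟨ cong₂ _+_ (rowSum≡2^n n) (rowSum≡2^n n) ⟩
  2 ^ n + 2 ^ n                                       ≡⟨ cong (2 ^ n +_) (+-identityʳ (2 ^ n)) ⟨
  2 ^ suc n                                           ∎
  where open ≡-Reasoning

-- Any common multiple can stand in for lcm(1, ..., N); the one used below is a product of prime
-- powers.
CommonMultiple : ℕ → ℕ → Set
CommonMultiple N X = ∀ j → 1 ≤ j → j ≤ N → j ∣ X

-- Leibniz' harmonic triangle: 1 / ((n+2) C(n+1,k+1)) is the difference of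
-- 1 / ((n+1) C(n,k)) and 1 / ((n+2) C(n+1,k)); times X, both are integers.
commonMultiple⇒[n+1]*nCk∣ : ∀ {X} n k → k ≤ n → CommonMultiple (suc n) X → suc n * (n C k) ∣ X
commonMultiple⇒[n+1]*nCk∣ {X} n zero _ cm = subst (_∣ X) (sym (*-identityʳ (suc n))) (cm (suc n) (s≤s z≤n) ≤-refl)
commonMultiple⇒[n+1]*nCk∣ {X} (suc n) (suc k) (s≤s k≤n) cm
  with commonMultiple⇒[n+1]*nCk∣ n k k≤n (λ j 1≤j j≤ → cm j 1≤j (m≤n⇒m≤1+n j≤))
     | commonMultiple⇒[n+1]*nCk∣ (suc n) k (m≤n⇒m≤1+n k≤n) cm
... | divides b X≡b*W | divides a X≡a*V =
  ∣m+n∣m⇒∣n (subst ((2 + n) * c ∣_) difference (m∣m*n b)) (m∣m*n a)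
  where
  open ≡-Reasoning
  c = suc n C suc k
  d = suc n C k
  W = suc n * (n C k)
  expand : ∀ n k c b → suc k * ((2 + n) * c * b) ≡ (2 + n) * (b * (suc k * c))
  expand = solve-∀
  peel : ∀ n x → (2 + n) * x ≡ x + suc n * x
  peel = solve-∀
  regroup₁ : ∀ n a d → suc n * (a * ((2 + n) * d)) ≡ a * (2 + n) * (suc n * d)
  regroup₁ = solve-∀
  regroup₂ : ∀ n k a d w → a * (2 + n) * (w + k * d) ≡ a * (2 + n) * w + k * (a * ((2 + n) * d))
  regroup₂ = solve-∀
  regroup₃ : ∀ n k a c x → x + (a * (2 + n) * (suc k * c) + k * x) ≡ suc k * ((2 + n) * c * a + x)
  regroup₃ = solve-∀
  -- This is 1/W - 1/((n+2)d) = 1/((n+2)c), multiplied by X and cleared of denominators. The factor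
  -- `suc k` allows `suc k * c` to be exchanged for `W`; `difference` cancels it.
  scaled : suc k * ((2 + n) * c * b) ≡ suc k * ((2 + n) * c * a + X)
  scaled = begin
    suc k * ((2 + n) * c * b)                   ≡⟨ expand n k c b ⟩
    (2 + n) * (b * (suc k * c))                 ≡⟨ cong (λ w → (2 + n) * (b * w)) ([k+1]*[n+1]C[k+1]≡[n+1]*nCk n k) ⟩
    (2 + n) * (b * W)                           ≡⟨ cong ((2 + n) *_) X≡b*W ⟨
    (2 + n) * X                                 ≡⟨ peel n X ⟩
    X + suc n * X                               ≡⟨ cong (λ x → X + suc n * x) X≡a*V ⟩
    X + suc n * (a * ((2 + n) * d))             ≡⟨ cong (X +_) (regroup₁ n a d) ⟩
    X + a * (2 + n) * (suc n * d)               ≡⟨ cong (λ v → X + a * (2 + n) * v) ([n+1]*[n+1]Ck≡[n+1]*nCk+k*[n+1]Ck n k) ⟩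
    X + a * (2 + n) * (W + k * d)               ≡⟨ cong (X +_) (regroup₂ n k a d W) ⟩
    X + (a * (2 + n) * W + k * (a * ((2 + n) * d))) ≡⟨ cong₂ (λ w x → X + (a * (2 + n) * w + k * x)) (sym ([k+1]*[n+1]C[k+1]≡[n+1]*nCk n k)) (sym X≡a*V) ⟩
    X + (a * (2 + n) * (suc k * c) + k * X)     ≡⟨ regroup₃ n k a c X ⟩
    suc k * ((2 + n) * c * a + X)               ∎
  difference : (2 + n) * c * b ≡ (2 + n) * c * a + X
  difference = *-cancelˡ-≡ _ _ (suc k) scaled

commonMultiple⇒2^n≤ : ∀ n X → .{{NonZero X}} → CommonMultiple (suc n) X → 2 ^ n ≤ X
commonMultiple⇒2^n≤ n X cm = *-cancelˡ-≤ (suc n) (subst (λ s → suc n * s ≤ suc n * X) (rowSum≡2^n n) (rowSum-bound (suc n) ≤-refl))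
  where
  open ≤-Reasoning
  rowSum-bound : ∀ m → m ≤ suc n → suc n * rowSum n m ≤ m * X
  rowSum-bound zero _ = ≤-reflexive (*-zeroʳ (suc n))
  rowSum-bound (suc m) m<1+n = begin
    suc n * (n C m + rowSum n m)         ≡⟨ *-distribˡ-+ (suc n) (n C m) _ ⟩
    suc n * (n C m) + suc n * rowSum n m ≤⟨ +-mono-≤ (∣⇒≤ (commonMultiple⇒[n+1]*nCk∣ n m (≤-pred m<1+n) cm)) (rowSum-bound m (<⇒≤ m<1+n)) ⟩
    X + m * X                            ∎

-- Products over primes

∏ₚ : (ℕ → ℕ) → ℕ → ℕ
∏ₚ f zero = 1
∏ₚ f (suc n) with prime? (suc n)
... | yes _ = f (suc n) * ∏ₚ f n
... | no _ = ∏ₚ f n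

π : ℕ → ℕ
π zero = 0
π (suc n) with prime? (suc n)
... | yes _ = suc (π n)
... | no _ = π n

π-prime : ∀ {n} → Prime (suc n) → π (suc n) ≡ suc (π n)
π-prime {n} pn with prime? (suc n)
... | yes _ = refl
... | no ¬pn = contradiction pn ¬pn

π-suc-≤ : ∀ n → π n ≤ π (suc n)
π-suc-≤ n with prime? (suc n)
... | yes _ = n≤1+n _
... | no _ = ≤-refl

π-mono : ∀ {m n} → m ≤ n → π m ≤ π n
π-mono {n = zero} z≤n = ≤-refl
π-mono {m} {suc n} m≤1+n with m≤n⇒m<n∨m≡n m≤1+n
... | inj₁ m<1+n = ≤-trans (π-mono (≤-pred m<1+n)) (π-suc-≤ n)
... | inj₂ refl = ≤-refl

∏ₚ-≤-^π : ∀ f N → (∀ p → f p ≤ N) → ∀ n → ∏ₚ f n ≤ N ^ π n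
∏ₚ-≤-^π f N f≤N zero = ≤-refl
∏ₚ-≤-^π f N f≤N (suc n) with prime? (suc n)
... | yes _ = *-mono-≤ (f≤N (suc n)) (∏ₚ-≤-^π f N f≤N n)
... | no _ = ∏ₚ-≤-^π f N f≤N n

π≤n : ∀ n → π n ≤ n
π≤n zero = z≤n
π≤n (suc n) with prime? (suc n)
... | yes _ = s≤s (π≤n n)
... | no _ = m≤n⇒m≤1+n (π≤n n)

∏ₚ-nonZero : ∀ f → (∀ p → Prime p → NonZero (f p)) → ∀ n → NonZero (∏ₚ f n)
∏ₚ-nonZero f f≢0 zero = _
∏ₚ-nonZero f f≢0 (suc n) with prime? (suc n)
... | yes pn = m*n≢0 (f (suc n)) (∏ₚ f n) {{f≢0 (suc n) pn}} {{∏ₚ-nonZero f f≢0 n}}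
... | no _ = ∏ₚ-nonZero f f≢0 n

∏ₚ-suc-prime : ∀ f {n} → Prime (suc n) → ∏ₚ f (suc n) ≡ f (suc n) * ∏ₚ f n
∏ₚ-suc-prime f {n} pn with prime? (suc n)
... | yes _ = refl
... | no ¬pn = contradiction pn ¬pn

∏ₚ-suc-nonprime : ∀ f {n} → ¬ Prime (suc n) → ∏ₚ f (suc n) ≡ ∏ₚ f n
∏ₚ-suc-nonprime f {n} ¬pn with prime? (suc n)
... | yes pn = contradiction pn ¬pn
... | no _ = refl

∏ₚ-primeless : ∀ f {a b} → a ≤ b → (∀ q → a < q → q ≤ b → ¬ Prime q) → ∏ₚ f b ≡ ∏ₚ f a
∏ₚ-primeless f {b = zero} z≤n _ = refl
∏ₚ-primeless f {a} {suc b} a≤1+b none with m≤n⇒m<n∨m≡n a≤1+b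
... | inj₂ refl = refl
... | inj₁ a<1+b = trans (∏ₚ-suc-nonprime f (none (suc b) a<1+b ≤-refl))
                         (∏ₚ-primeless f (≤-pred a<1+b) (λ q a<q q≤b → none q a<q (m≤n⇒m≤1+n q≤b)))

-- Prime powers bounded by N

-- The argument `k` bounds the search for the exponent. For b > 1 the choice k = N is large enough,
-- because e < b ^ e ≤ N.
floorLog : (b N k : ℕ) → ℕ
floorLog b N zero = 0
floorLog b N (suc k) with b ^ suc k ≤? N
... | yes _ = suc k
... | no _ = floorLog b N k

^floorLog-≤ : ∀ b N .{{_ : NonZero N}} k → b ^ floorLog b N k ≤ N
^floorLog-≤ b N zero = >-nonZero⁻¹ N
^floorLog-≤ b N (suc k) with b ^ suc k ≤? N
... | yes b^≤N = b^≤N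
... | no _ = ^floorLog-≤ b N k

floorLog-max : ∀ b N k {e} → e ≤ k → b ^ e ≤ N → e ≤ floorLog b N k
floorLog-max b N zero e≤0 _ = e≤0
floorLog-max b N (suc k) e≤1+k b^e≤N with b ^ suc k ≤? N
... | yes _ = e≤1+k
... | no b^≰N with m≤n⇒m<n∨m≡n e≤1+k
...   | inj₁ e<1+k = floorLog-max b N k (≤-pred e<1+k) b^e≤N
...   | inj₂ refl = contradiction b^e≤N b^≰N

n<b^n : ∀ b → 1 < b → ∀ n → n < b ^ n
n<b^n b 1<b zero = s≤s z≤n
n<b^n b 1<b (suc n) = begin-strict
  suc n          ≤⟨ n<b^n b 1<b n ⟩
  b ^ n          <⟨ ^-monoʳ-< b 1<b (n<1+n n) ⟩
  b ^ suc n      ∎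
  where open ≤-Reasoning

-- For prime `b` this is the exact power of `b` in lcm(1, ..., N).
maxPower : ℕ → ℕ → ℕ
maxPower N b = b ^ floorLog b N N

maxPower-≤ : ∀ N .{{_ : NonZero N}} b → maxPower N b ≤ N
maxPower-≤ N b = ^floorLog-≤ b N N

^-mono-∣ : ∀ b {m n} → m ≤ n → b ^ m ∣ b ^ n
^-mono-∣ b {m} {n} m≤n = divides (b ^ (n ∸ m)) (trans (cong (b ^_) (sym (m∸n+n≡m m≤n))) (^-distribˡ-+-* b (n ∸ m) m))

^-∣-maxPower : ∀ {N b e} → 1 < b → b ^ e ≤ N → b ^ e ∣ maxPower N b
^-∣-maxPower {N} {b} {e} 1<b b^e≤N =
  ^-mono-∣ b (floorLog-max b N N (≤-trans (<⇒≤ (n<b^n b 1<b e)) b^e≤N) b^e≤N)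

-- An exponent of 2 or more would force b * b ≤ N. Hence primes above √N enter the product at most
-- once.
maxPower-≤-base : ∀ {N b} .{{_ : NonZero N}} → 1 < b → N < b * b → maxPower N b ≤ b
maxPower-≤-base {N} {b} 1<b N<b*b with floorLog b N N in eq
... | 0 = <⇒≤ 1<b
... | 1 = ≤-reflexive (*-identityʳ b)
... | suc (suc e) = contradiction (begin-strict
  N                     <⟨ N<b*b ⟩
  b * b                 ≤⟨ *-monoʳ-≤ b (m≤m*n b (b ^ e) {{m^n≢0 b e {{>-nonZero (<-trans (s≤s z≤n) 1<b)}}}}) ⟩
  b ^ (2 + e)           ≡⟨ cong (b ^_) eq ⟨
  maxPower N b          ≤⟨ maxPower-≤ N b ⟩
  N                     ∎) (<-irrefl refl)
  where open ≤-Reasoning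

prime>1 : ∀ {p} → Prime p → 1 < p
prime>1 {p} pp = nonTrivial⇒n>1 p {{prime⇒nonTrivial pp}}

extractPower : ∀ {p} → 1 < p → ∀ n → .{{NonZero n}} → ∃[ e ] ∃[ m ] (n ≡ p ^ e * m × ¬ p ∣ m)
extractPower {p} 1<p n = <-rec (λ n → .{{NonZero n}} → ∃[ e ] ∃[ m ] (n ≡ p ^ e * m × ¬ p ∣ m)) step n
  where
  step : ∀ n → (∀ {m} → m < n → .{{NonZero m}} → ∃[ e ] ∃[ k ] (m ≡ p ^ e * k × ¬ p ∣ k)) →
         .{{NonZero n}} → ∃[ e ] ∃[ m ] (n ≡ p ^ e * m × ¬ p ∣ m)
  step n rec with p ∣? n
  ... | no p∤n = 0 , n , sym (+-identityʳ n) , p∤n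
  ... | yes p∣n with rec (quotient-< p∣n {{n>1⇒nonTrivial 1<p}}) {{quotient≢0 p∣n}}
  ...   | e , m , q≡ , p∤m = suc e , m , n≡ , p∤m
    where
    open ≡-Reasoning
    n≡ : n ≡ p ^ suc e * m
    n≡ = begin
      n                   ≡⟨ m∣n⇒n≡m*quotient p∣n ⟩
      p * quotient p∣n    ≡⟨ cong (p *_) q≡ ⟩
      p * (p ^ e * m)     ≡⟨ *-assoc p (p ^ e) m ⟨
      p ^ suc e * m       ∎

noPrimeFactor⇒≡1 : ∀ n → .{{NonZero n}} → (∀ p → Prime p → ¬ p ∣ n) → n ≡ 1
noPrimeFactor⇒≡1 n none with factorise n
... | record { factors = [] ; isFactorisation = eq } = eq
... | record { factors = p ∷ ps ; isFactorisation = eq ; factorsPrime = pp ∷ _ } =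
  contradiction (subst (p ∣_) (sym eq) (m∣m*n _)) (none p pp)

-- Induction on the smoothness bound, with N fixed: splitting off the full power of the prime
-- `suc B` leaves a cofactor that is still at most N and has no prime factor above `B`.
smooth⇒∣∏ₚ-maxPower : ∀ {N} B n → .{{NonZero n}} → n ≤ N → (∀ p → Prime p → p ∣ n → p ≤ B) → n ∣ ∏ₚ (maxPower N) B
smooth⇒∣∏ₚ-maxPower zero n n≤N smooth = ∣-reflexive (noPrimeFactor⇒≡1 n λ p pp p∣n →
  n≮0 (<-≤-trans (prime>1 pp) (smooth p pp p∣n)))
smooth⇒∣∏ₚ-maxPower {N} (suc B) n n≤N smooth with prime? (suc B)
... | no ¬pB = smooth⇒∣∏ₚ-maxPower B n n≤N λ p pp p∣n →
  ≤-pred (≤∧≢⇒< (smooth p pp p∣n) λ { refl → ¬pB pp })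
... | yes pB with extractPower (prime>1 pB) n
...   | e , m , refl , p∤m = *-pres-∣
  (^-∣-maxPower {e = e} (prime>1 pB) (≤-trans (m≤m*n (suc B ^ e) m) n≤N))
  (smooth⇒∣∏ₚ-maxPower B m (≤-trans (m≤n*m m (suc B ^ e) {{m^n≢0 (suc B) e}}) n≤N) λ p pp p∣m →
    ≤-pred (≤∧≢⇒< (smooth p pp (∣n⇒∣m*n (suc B ^ e) p∣m)) λ { refl → p∤m p∣m }))
  where instance
    m≢0 : NonZero m
    m≢0 = m*n≢0⇒n≢0 (suc B ^ e)

∏ₚ-maxPower-commonMultiple : ∀ N → CommonMultiple N (∏ₚ (maxPower N) N)
∏ₚ-maxPower-commonMultiple N j 1≤j j≤N =
  smooth⇒∣∏ₚ-maxPower N j {{>-nonZero 1≤j}} j≤N (λ p _ p∣j → ≤-trans (∣⇒≤ {{>-nonZero 1≤j}} p∣j) j≤N)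

2^n≤∏ₚ-maxPower : ∀ n → 2 ^ n ≤ ∏ₚ (maxPower (suc n)) (suc n)
2^n≤∏ₚ-maxPower n = commonMultiple⇒2^n≤ n _
  {{∏ₚ-nonZero _ (λ p pp → m^n≢0 p (floorLog p (suc n) (suc n)) {{prime⇒nonZero pp}}) (suc n)}}
  (∏ₚ-maxPower-commonMultiple (suc n))

2^n≤[n+1]^π : ∀ n → 2 ^ n ≤ suc n ^ π (suc n)
2^n≤[n+1]^π n = ≤-trans (2^n≤∏ₚ-maxPower n) (∏ₚ-≤-^π (maxPower (suc n)) (suc n) (maxPower-≤ (suc n)) (suc n))

-- Primorials

primorial : ℕ → ℕ
primorial = ∏ₚ id

primorial-nonZero : ∀ n → NonZero (primorial n)
primorial-nonZero = ∏ₚ-nonZero id (λ _ → prime⇒nonZero)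

-- There are at most `s` primes up to `s`, each contributing at most N; a prime above `s`
-- contributes at most itself, which the primorial accounts for. Any `s` with (s+1)² > N is allowed,
-- so a crude estimate of √N can be used.
∏ₚ-maxPower-≤ : ∀ N .{{_ : NonZero N}} s → N < suc s * suc s → ∀ n → ∏ₚ (maxPower N) n ≤ N ^ s * primorial n
∏ₚ-maxPower-≤ N s N<[1+s]² n with n ≤? s
... | yes n≤s = begin
  ∏ₚ (maxPower N) n   ≤⟨ ∏ₚ-≤-^π (maxPower N) N (maxPower-≤ N) n ⟩
  N ^ π n             ≤⟨ ^-monoʳ-≤ N (≤-trans (π≤n n) n≤s) ⟩
  N ^ s               ≤⟨ m≤m*n (N ^ s) (primorial n) {{primorial-nonZero n}} ⟩
  N ^ s * primorial n ∎
  where open ≤-Reasoning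
∏ₚ-maxPower-≤ N s N<[1+s]² zero | no 0≰s = contradiction z≤n 0≰s
∏ₚ-maxPower-≤ N s N<[1+s]² (suc n) | no n≰s with prime? (suc n)
... | no _ = ∏ₚ-maxPower-≤ N s N<[1+s]² n
... | yes pn = begin
  maxPower N (suc n) * ∏ₚ (maxPower N) n ≤⟨ *-mono-≤ (maxPower-≤-base (prime>1 pn) N<[1+n]²) (∏ₚ-maxPower-≤ N s N<[1+s]² n) ⟩
  suc n * (N ^ s * primorial n)          ≡⟨ swap (suc n) (N ^ s) (primorial n) ⟩
  N ^ s * (suc n * primorial n)          ∎
  where
  open ≤-Reasoning
  N<[1+n]² : N < suc n * suc n
  N<[1+n]² = <-≤-trans N<[1+s]² (*-mono-≤ (≰⇒> n≰s) (≰⇒> n≰s))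
  swap : ∀ a b c → a * (b * c) ≡ b * (a * c)
  swap = solve-∀

prime∣!⇒≤ : ∀ {p} n → Prime p → p ∣ n ! → p ≤ n
prime∣!⇒≤ zero pp p∣1 = contradiction (subst Prime (∣1⇒≡1 p∣1) pp) ¬prime[1]
prime∣!⇒≤ (suc n) pp p∣n! with euclidsLemma (suc n) (n !) pp p∣n!
... | inj₁ p∣1+n = ∣⇒≤ p∣1+n
... | inj₂ p∣n! = m≤n⇒m≤1+n (prime∣!⇒≤ n pp p∣n!)

prime∣primorial⇒≤ : ∀ {p} n → Prime p → p ∣ primorial n → p ≤ n
prime∣primorial⇒≤ zero pp p∣1 = contradiction (subst Prime (∣1⇒≡1 p∣1) pp) ¬prime[1]
prime∣primorial⇒≤ (suc n) pp p∣ with prime? (suc n)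
... | no _ = m≤n⇒m≤1+n (prime∣primorial⇒≤ n pp p∣)
... | yes _ with euclidsLemma (suc n) (primorial n) pp p∣
...   | inj₁ p∣1+n = ∣⇒≤ p∣1+n
...   | inj₂ p∣primorial = m≤n⇒m≤1+n (prime∣primorial⇒≤ n pp p∣primorial)

-- Distinct primes dividing Y accumulate: if `primorial a * Y` is `z * primorial b`, the next prime
-- `suc b` divides this product but not `primorial b`, whose prime factors are at most `b`, so it
-- divides `z`.
primorial-∣ : ∀ {a Y} b → a ≤ b → (∀ p → Prime p → a < p → p ≤ b → p ∣ Y) → primorial b ∣ primorial a * Y
primorial-∣ {Y = Y} zero z≤n _ = 1∣ _
primorial-∣ {a} {Y} (suc b) a≤1+b divisible with m≤n⇒m<n∨m≡n a≤1+b
... | inj₂ refl = m∣m*n Y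
... | inj₁ a<1+b with prime? (suc b) | primorial-∣ b (≤-pred a<1+b) (λ p pp a<p p≤b → divisible p pp a<p (m≤n⇒m≤1+n p≤b))
...   | no _ | ih = ih
...   | yes pb | divides z eq with euclidsLemma z (primorial b) pb (subst (suc b ∣_) eq (∣n⇒∣m*n (primorial a) (divisible (suc b) pb a<1+b ≤-refl)))
...     | inj₁ p∣z = subst (suc b * primorial b ∣_) (sym eq) (*-monoˡ-∣ (primorial b) p∣z)
...     | inj₂ p∣primorial = contradiction (prime∣primorial⇒≤ b pb p∣primorial) 1+n≰n

n∣n! : ∀ n → .{{NonZero n}} → n ∣ n !
n∣n! (suc n) = m∣m*n (n !)

nCk*k![n∸k]!≡n! : ∀ {n k} → k ≤ n → (n C k) * (k ! * (n ∸ k) !) ≡ n !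
nCk*k![n∸k]!≡n! {n} {k} k≤n =
  trans (cong (_* (k ! * (n ∸ k) !)) (nCk≡n!/k![n-k]! k≤n)) (m/n*n≡m (k![n∸k]!∣n! k≤n))
  where instance _ = k !* (n ∸ k) !≢0

-- The prime divides n! but neither k! nor (n-k)!.
prime∣nCk : ∀ {n k p} → k ≤ n → Prime p → k < p → n ∸ k < p → p ≤ n → p ∣ n C k
prime∣nCk {n} {k} {p} k≤n pp k<p n∸k<p p≤n
  with euclidsLemma (n C k) (k ! * (n ∸ k) !) pp
         (subst (p ∣_) (sym (nCk*k![n∸k]!≡n! k≤n)) (∣-trans (n∣n! p {{prime⇒nonZero pp}}) (m≤n⇒m!∣n! p≤n)))
... | inj₁ p∣nCk = p∣nCk
... | inj₂ p∣k!l! with euclidsLemma (k !) ((n ∸ k) !) pp p∣k!l!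
...   | inj₁ p∣k! = contradiction (prime∣!⇒≤ k pp p∣k!) (<⇒≱ k<p)
...   | inj₂ p∣l! = contradiction (prime∣!⇒≤ (n ∸ k) pp p∣l!) (<⇒≱ n∸k<p)

even-or-odd : ∀ n → ∃[ m ] (n ≡ 2 * m ⊎ n ≡ suc (2 * m))
even-or-odd zero = 0 , inj₁ refl
even-or-odd (suc n) with even-or-odd n
... | m , inj₁ refl = m , inj₂ refl
... | m , inj₂ refl = suc m , inj₁ (cong suc (sym (+-suc m (m + 0))))

even-prime : ∀ m → Prime (2 * m) → 2 ≡ 2 * m
even-prime m p2m with prime⇒irreducible p2m {2} (m∣m*n m)
... | inj₂ 2≡2m = 2≡2m

-- Every prime in (m+1, 2m+1] divides C(2m+1,m), which is at most 4^m as the sum of two adjacent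
-- entries of row 2m.
primorial-odd-≤ : ∀ m → primorial (suc (2 * m)) ≤ primorial (suc m) * 4 ^ m
primorial-odd-≤ m = begin
  primorial n                ≤⟨ ∣⇒≤ {{m*n≢0 _ _ {{primorial-nonZero (suc m)}} {{nCk≢0}}}}
                                  (primorial-∣ n (s≤s m≤2m) λ p pp 1+m<p p≤n →
                                    prime∣nCk m≤n pp (<-trans (n<1+n m) 1+m<p) (subst (_< p) (sym n∸m≡) 1+m<p) p≤n) ⟩
  primorial (suc m) * (n C m) ≤⟨ *-monoʳ-≤ (primorial (suc m)) nCm≤4^m ⟩
  primorial (suc m) * 4 ^ m  ∎
  where
  open ≤-Reasoning
  n = suc (2 * m)
  m≤2m : m ≤ 2 * m
  m≤2m = m≤m+n m (m + 0)
  m≤n : m ≤ n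
  m≤n = m≤n⇒m≤1+n m≤2m
  n∸m≡ : n ∸ m ≡ suc m
  n∸m≡ = trans (cong (_∸ m) (trans (cong suc (cong (m +_) (+-identityʳ m))) (sym (+-suc m m)))) (m+n∸m≡n m (suc m))
  nCk≢0 : NonZero (n C m)
  nCk≢0 = m*n≢0⇒m≢0 (n C m) {{subst NonZero (sym (nCk*k![n∸k]!≡n! m≤n)) (n !≢0)}}
  nCm≤4^m : n C m ≤ 4 ^ m
  nCm≤4^m = subst (n C m ≤_) (sym (^-*-assoc 2 2 m)) (bound m)
    where
    bound : ∀ m → suc (2 * m) C m ≤ 2 ^ (2 * m)
    bound zero = ≤-refl
    bound (suc k) = begin
      suc (2 * suc k) C suc k                       ≡⟨ nCk+nC[k+1]≡[n+1]C[k+1] (2 * suc k) k ⟨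
      (2 * suc k) C k + (2 * suc k) C suc k         ≤⟨ nCk+nC[k+1]≤2^n (2 * suc k) k ⟩
      2 ^ (2 * suc k)                               ∎

primorial≤4^n : ∀ n → primorial n ≤ 4 ^ n
primorial≤4^n = <-rec (λ n → primorial n ≤ 4 ^ n) step
  where
  open ≤-Reasoning
  step : ∀ n → (∀ {m} → m < n → primorial m ≤ 4 ^ m) → primorial n ≤ 4 ^ n
  step zero _ = ≤-refl
  step (suc n) rec with prime? (suc n)
  ... | no _ = ≤-trans (rec ≤-refl) (^-monoʳ-≤ 4 (n≤1+n n))
  ... | yes pn with even-or-odd (suc n)
  ...   | m , inj₁ 1+n≡2m with trans 1+n≡2m (sym (even-prime m (subst Prime 1+n≡2m pn)))
  -- The only even prime is 2, where the claim reads 2 ≤ 16.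
  ...     | refl = m≤m+n 2 14
  step (suc n) rec | yes pn | zero , inj₂ refl = contradiction pn ¬prime[1]
  step (suc n) rec | yes pn | suc m , inj₂ refl = begin
    suc n * primorial n             ≡⟨ ∏ₚ-suc-prime id pn ⟨
    primorial (suc n)               ≤⟨ primorial-odd-≤ (suc m) ⟩
    primorial (2 + m) * 4 ^ suc m   ≤⟨ *-monoˡ-≤ (4 ^ suc m) (rec (s≤s (s≤s (m<m+n m (s≤s z≤n))))) ⟩
    4 ^ (2 + m) * 4 ^ suc m         ≡⟨ ^-distribˡ-+-* 4 (2 + m) (suc m) ⟨
    4 ^ (2 + m + suc m)             ≡⟨ cong (4 ^_) (exponent m) ⟩
    4 ^ suc (2 * suc m)             ∎
    where
    exponent : ∀ m → 2 + m + suc m ≡ suc (2 * suc m)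
    exponent = solve-∀

-- A weak form of Bertrand's postulate

2^-reflects-≤ : ∀ {m n} → 2 ^ m ≤ 2 ^ n → m ≤ n
2^-reflects-≤ {m} {n} 2^m≤2^n = ≮⇒≥ λ n<m → <⇒≱ (^-monoʳ-< 2 ≤-refl n<m) 2^m≤2^n

BertrandPrime : ℕ → Set
BertrandPrime x = ∃[ t ] (Prime t × x < t × t < 2 * x)

-- Each prime of the chain is less than twice its predecessor, so for p ≤ x < q the prime q lies in
-- (x, 2x). The chain runs past the bound 2048 of `isolated⇒small`.
bertrand-small : ∀ x → 2 ≤ x → x < 2503 → BertrandPrime x
bertrand-small x 2≤x x<2503 =
  step 2 3 2≤x λ h → step 3 5 h λ h → step 5 7 h λ h → step 7 13 h λ h → step 13 23 h λ h →
  step 23 43 h λ h → step 43 83 h λ h → step 83 163 h λ h → step 163 317 h λ h →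
  step 317 631 h λ h → step 631 1259 h λ h → step 1259 2503 h λ h → contradiction h (<⇒≱ x<2503)
  where
  step : ∀ p q {_ : True (prime? q)} {_ : True (q <? 2 * p)} → p ≤ x → (q ≤ x → BertrandPrime x) → BertrandPrime x
  step p q {pq} {q<2p} p≤x continue with q ≤? x
  ... | yes q≤x = continue q≤x
  ... | no q≰x = q , toWitness pq , ≰⇒> q≰x , <-≤-trans (toWitness q<2p) (*-monoʳ-≤ 2 p≤x)

8[k+1]<2^k : ∀ k → 6 ≤ k → 8 * suc k < 2 ^ k
8[k+1]<2^k k 6≤k = subst (λ k → 8 * suc k < 2 ^ k) (m+[n∸m]≡n 6≤k) (from-6 (k ∸ 6))
  where
  open ≤-Reasoning
  split : ∀ j → 8 * suc (6 + suc j) ≡ 8 + 8 * suc (6 + j)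
  split = solve-∀
  from-6 : ∀ j → 8 * suc (6 + j) < 2 ^ (6 + j)
  from-6 zero = m≤m+n 57 7
  from-6 (suc j) = begin-strict
    8 * suc (6 + suc j)         ≡⟨ split j ⟩
    8 + 8 * suc (6 + j)         <⟨ +-mono-≤-< (≤-trans (m≤m*n 8 (suc (6 + j))) (<⇒≤ (from-6 j))) (from-6 j) ⟩
    2 ^ (6 + j) + 2 ^ (6 + j)   ≡⟨ cong (2 ^ (6 + j) +_) (+-identityʳ _) ⟨
    2 ^ (6 + suc j)             ∎

-- Together with y < 2x this says that y is another prime in (x/2, 2x); that upper bound is kept
-- apart because the bounded search for y supplies it.
Neighbour : ℕ → ℕ → Set
Neighbour x y = Prime y × y ≢ x × x < 2 * y

-- Write x for the isolated prime, N = 2x and h = ⌊x/2⌋. In the estimate for 2^(N-1) only x itself,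
-- contributing at most N, and the primes up to h survive; the latter contribute at most N^s 4^h ≤
-- N^s 2^x. Cancelling 2^x leaves the claim.
isolated⇒2^[x∸1]≤ : ∀ x s → Prime (suc x) → (∀ y → y < 2 * suc x → ¬ Neighbour (suc x) y) →
                    2 * suc x < suc s * suc s → 2 ^ x ≤ (2 * suc x) ^ suc s
isolated⇒2^[x∸1]≤ x′ s px isolated N<[1+s]² with even-or-odd (suc x′)
... | h , parity = *-cancelʳ-≤ (2 ^ x′) (N ^ suc s) (2 ^ x) {{m^n≢0 2 x}} (begin
  2 ^ x′ * 2 ^ x                          ≡⟨ ^-distribˡ-+-* 2 x′ x ⟨
  2 ^ (x′ + x)                            ≡⟨ cong (λ y → 2 ^ (x′ + y)) (+-identityʳ x) ⟨
  2 ^ (x′ + (x + 0))                      ≤⟨ 2^n≤∏ₚ-maxPower (x′ + (x + 0)) ⟩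
  ∏ₚ (maxPower N) N                       ≡⟨ ∏ₚ-primeless (maxPower N) (m≤m+n x (x + 0)) above ⟩
  ∏ₚ (maxPower N) x                       ≡⟨ ∏ₚ-suc-prime (maxPower N) px ⟩
  maxPower N x * ∏ₚ (maxPower N) x′       ≡⟨ cong (maxPower N x *_) (∏ₚ-primeless (maxPower N) h≤x′ below) ⟩
  maxPower N x * ∏ₚ (maxPower N) h        ≤⟨ *-mono-≤ (maxPower-≤ N x) (∏ₚ-maxPower-≤ N s N<[1+s]² h) ⟩
  N * (N ^ s * primorial h)               ≡⟨ *-assoc N (N ^ s) (primorial h) ⟨
  N ^ suc s * primorial h                 ≤⟨ *-monoʳ-≤ (N ^ suc s) (primorial≤4^n h) ⟩
  N ^ suc s * 4 ^ h                       ≡⟨ cong (N ^ suc s *_) (^-*-assoc 2 2 h) ⟩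
  N ^ suc s * 2 ^ (2 * h)                 ≤⟨ *-monoʳ-≤ (N ^ suc s) (^-monoʳ-≤ 2 2h≤x) ⟩
  N ^ suc s * 2 ^ x                       ∎)
  where
  open ≤-Reasoning
  x = suc x′
  N = 2 * x
  2h≤x : 2 * h ≤ x
  2h≤x = [ (λ eq → ≤-reflexive (sym eq)) , (λ eq → ≤-trans (n≤1+n _) (≤-reflexive (sym eq))) ]′ parity
  x≤1+2h : x ≤ suc (2 * h)
  x≤1+2h = [ (λ eq → ≤-trans (≤-reflexive eq) (n≤1+n _)) , ≤-reflexive ]′ parity
  x<2q : ∀ {q} → h < q → x < 2 * q
  x<2q {q} h<q = begin-strict
    x             ≤⟨ x≤1+2h ⟩
    1 + 2 * h     <⟨ ≤-refl ⟩
    2 + 2 * h     ≡⟨ *-suc 2 h ⟨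
    2 * suc h     ≤⟨ *-monoʳ-≤ 2 h<q ⟩
    2 * q         ∎
  h≤x′ : h ≤ x′
  h≤x′ = ≮⇒≥ λ x≤h → <⇒≱ (m<m+n x (s≤s z≤n)) (≤-trans (*-monoʳ-≤ 2 x≤h) 2h≤x)
  above : ∀ q → x < q → q ≤ N → ¬ Prime q
  above q x<q q≤N pq with m≤n⇒m<n∨m≡n q≤N
  ... | inj₁ q<N = isolated q q<N (pq , (λ q≡x → <-irrefl (sym q≡x) x<q) , <-≤-trans x<q (m≤m+n q (q + 0)))
  -- The endpoint 2x is even, so it could be prime only for x = 1.
  ... | inj₂ refl = ¬prime[1] (subst Prime (sym (*-cancelˡ-≡ 1 x 2 (even-prime x pq))) px)
  below : ∀ q → h < q → q ≤ x′ → ¬ Prime q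
  below q h<q q≤x′ pq = isolated q (<-≤-trans (s≤s q≤x′) (m≤m+n x (x + 0)))
    (pq , (λ q≡x → <-irrefl q≡x (s≤s q≤x′)) , x<2q h<q)

-- With 4^k ≤ N < 4^(k+1), the number a = 2^(k+1) exceeds √N. Then 2^(x-1) ≤ N^a < 2^(2(k+1)a) gives
-- x ≤ 2(k+1)a, so 4^k ≤ 2x ≤ 8(k+1) 2^k, which fails for k ≥ 6.
isolated⇒small : ∀ {x} → Prime x → (∀ y → y < 2 * x → ¬ Neighbour x y) → x < 2048
isolated⇒small {zero} p0 _ = contradiction p0 ¬prime[0]
isolated⇒small {suc x′} px isolated = ≰⇒> λ 2048≤x →
  -- From x ≥ 2048 follows N ≥ 4096 = 4^6, hence k ≥ 6; the bound 6 ≤ 4096 ≤ N keeps the exponent 6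
  -- within the search range.
  <⇒≱ (8[k+1]<2^k k (floorLog-max 4 N N (≤-trans (m≤m+n 6 4090) (*-monoʳ-≤ 2 2048≤x)) (*-monoʳ-≤ 2 2048≤x))) 2^k≤8[k+1]
  where
  open ≤-Reasoning
  x = suc x′
  N = 2 * x
  k = floorLog 4 N N
  a = 2 ^ suc k
  s = pred a
  1+s≡a : suc s ≡ a
  1+s≡a = suc-pred a {{m^n≢0 2 (suc k)}}
  square : ∀ b → b * b ≡ b ^ 2
  square b = cong (b *_) (sym (*-identityʳ b))
  a²≡ : a * a ≡ 4 ^ suc k
  a²≡ = trans (square a) (trans (^-*-assoc 2 (suc k) 2) (trans (cong (2 ^_) (*-comm (suc k) 2)) (sym (^-*-assoc 2 2 (suc k)))))
  N<4^[1+k] : N < 4 ^ suc k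
  N<4^[1+k] = ≰⇒> λ 4^≤N → 1+n≰n (floorLog-max 4 N N (≤-trans (<⇒≤ (n<b^n 4 (s≤s (s≤s z≤n)) (suc k))) 4^≤N) 4^≤N)
  bound : 2 ^ x′ ≤ N ^ a
  bound = subst (λ b → 2 ^ x′ ≤ N ^ b) 1+s≡a (isolated⇒2^[x∸1]≤ x′ s px isolated
    (subst (N <_) (sym (trans (cong₂ _*_ 1+s≡a 1+s≡a) a²≡)) N<4^[1+k]))
  x≤ : x ≤ 2 * suc k * a
  x≤ = ≰⇒> λ exponent≤x′ → <⇒≱ (begin-strict
    N ^ a                     <⟨ ^-monoˡ-< a {{m^n≢0 2 (suc k)}} N<4^[1+k] ⟩
    (4 ^ suc k) ^ a           ≡⟨ cong (_^ a) (^-*-assoc 2 2 (suc k)) ⟩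
    (2 ^ (2 * suc k)) ^ a     ≡⟨ ^-*-assoc 2 (2 * suc k) a ⟩
    2 ^ (2 * suc k * a)       ≤⟨ ^-monoʳ-≤ 2 exponent≤x′ ⟩
    2 ^ x′                    ∎) bound
  regroup : ∀ k b → 2 * (2 * suc k * (2 * b)) ≡ 8 * suc k * b
  regroup = solve-∀
  2^k≤8[k+1] : 2 ^ k ≤ 8 * suc k
  2^k≤8[k+1] = *-cancelʳ-≤ (2 ^ k) (8 * suc k) (2 ^ k) {{m^n≢0 2 k}} (begin
    2 ^ k * 2 ^ k             ≡⟨ ^-distribˡ-+-* 2 k k ⟨
    2 ^ (k + k)               ≡⟨ cong (λ j → 2 ^ (k + j)) (+-identityʳ k) ⟨
    2 ^ (2 * k)               ≡⟨ ^-*-assoc 2 2 k ⟨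
    4 ^ k                     ≤⟨ ^floorLog-≤ 4 N N ⟩
    2 * x                     ≤⟨ *-monoʳ-≤ 2 x≤ ⟩
    2 * (2 * suc k * a)       ≡⟨ regroup k (2 ^ k) ⟩
    8 * suc k * 2 ^ k         ∎)

-- If the search fails, x is isolated and hence small, and the explicit chain of primes supplies a
-- neighbour.
neighbour : ∀ {x} → Prime x → ∃[ y ] (y < 2 * x × Neighbour x y)
neighbour {x} px with anyUpTo? (λ y → prime? y ×-dec ¬? (y ≟ x) ×-dec (x <? 2 * y)) (2 * x)
... | yes found = found
... | no none with bertrand-small x (prime>1 px) (<-≤-trans (isolated⇒small px (λ y y<2x nb → none (y , y<2x , nb))) (m≤m+n 2048 455))
...   | t , pt , x<t , t<2x = t , t<2x , pt , (λ t≡x → <-irrefl (sym t≡x) x<t) , <-≤-trans x<t (m≤m+n t (t + 0))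

-- RPR-primes and blocks

least : ∀ {P : ℕ → Set} → Decidable P → ∀ n → P n → ∃[ m ] IsLeast P m
least {P} P? = <-rec (λ n → P n → ∃[ m ] IsLeast P m) step
  where
  step : ∀ n → (∀ {m} → m < n → P m → ∃[ k ] IsLeast P k) → P n → ∃[ m ] IsLeast P m
  step n rec Pn with anyUpTo? P? n
  ... | yes (m , m<n , Pm) = rec m<n Pm
  ... | no none = n , Pn , λ y Py → ≮⇒≥ λ y<n → none (y , y<n , Py)

largestPrimeBelow-2*-isGreatest : ∀ {q} → Prime q → IsGreatest (PrimeBelow (2 * q)) (largestPrimeBelow (2 * q))
largestPrimeBelow-2*-isGreatest pq = S-step pq 0

-- As x < 2q, the least admissible q₀ is at most q; a prime t in (x, 2q₀) would then be a prime
-- below 2q larger than the greatest one.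
image⇒¬RPR : ∀ {q x} → Prime q → largestPrimeBelow (2 * q) ≡ x → ¬ IsRPR x
image⇒¬RPR {q} pq refl (_ , q₀ , (_ , q₀-min) , t , pt , x<t , t<2q₀)
  with largestPrimeBelow-2*-isGreatest pq
... | (_ , x<2q) , x-max =
  <⇒≱ x<t (x-max t (pt , <-≤-trans t<2q₀ (*-monoʳ-≤ 2 (q₀-min q (pq , x<2q)))))

-- Take the least prime q with x < 2q, and let t be the largest prime below 2q, so x ≤ t. If x < t,
-- then t witnesses that x is RPR; otherwise x = t is the image of q.
RPR-or-image : ∀ {x} → Prime x → IsRPR x ⊎ ∃[ q ] (Prime q × q < x × largestPrimeBelow (2 * q) ≡ x)
RPR-or-image {x} px
  with least (λ q → prime? q ×-dec (x <? 2 * q)) x (px , m<m+n x (≤-trans (<⇒≤ (prime>1 px)) (m≤m+n x 0)))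
... | q , (pq , x<2q) , q-min with largestPrimeBelow-2*-isGreatest pq
...   | (pt , t<2q) , t-max with m≤n⇒m<n∨m≡n (t-max x (px , x<2q))
...     | inj₁ x<t = inj₁ (px , q , ((pq , x<2q) , q-min) , _ , pt , x<t , t<2q)
...     | inj₂ x≡t = inj₂ (q , pq , q<x , sym x≡t)
  where
  q≤neighbour : ∀ {y} → Neighbour x y → q ≤ y
  q≤neighbour {y} (py , _ , x<2y) = q-min y (py , x<2y)
  q≢x : q ≢ x
  q≢x refl with neighbour px
  ... | y , y<2x , nb@(py , y≢x , x<2y) =
    -- If q = x, the largest prime below 2x is x, so the neighbour is at most x; by minimality of q
    -- it is also at least x.
    y≢x (≤-antisym (subst (y ≤_) (sym x≡t) (t-max y (py , y<2x))) (q≤neighbour nb))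
  q<x : q < x
  q<x = ≤∧≢⇒< (q-min x (px , m<m+n x (≤-trans (<⇒≤ (prime>1 px)) (m≤m+n x 0)))) q≢x

-- The dichotomy decides the property without searching for the two existential witnesses.
isRPR? : Decidable IsRPR
isRPR? x with prime? x
... | no ¬px = no λ rpr → ¬px (proj₁ rpr)
... | yes px with RPR-or-image px
...   | inj₁ rpr = yes rpr
...   | inj₂ (q , pq , _ , eq) = no (image⇒¬RPR pq eq)

-- Infinitude of RPR-primes

2*⌊n/2⌋≤n : ∀ n → 2 * ⌊ n /2⌋ ≤ n
2*⌊n/2⌋≤n n = begin
  ⌊ n /2⌋ + (⌊ n /2⌋ + 0)  ≡⟨ cong (⌊ n /2⌋ +_) (+-identityʳ _) ⟩
  ⌊ n /2⌋ + ⌊ n /2⌋        ≤⟨ +-monoʳ-≤ ⌊ n /2⌋ (⌊n/2⌋≤⌈n/2⌉ n) ⟩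
  ⌊ n /2⌋ + ⌈ n /2⌉        ≡⟨ ⌊n/2⌋+⌈n/2⌉≡n n ⟩
  n                        ∎
  where open ≤-Reasoning

⌊2*n/2⌋≡n : ∀ n → ⌊ 2 * n /2⌋ ≡ n
⌊2*n/2⌋≡n n = sym (trans (n≡⌊n+n/2⌋ n) (cong (λ m → ⌊ n + m /2⌋) (sym (+-identityʳ n))))

m²≤2^m : ∀ m → 4 ≤ m → m * m ≤ 2 ^ m
m²≤2^m m 4≤m = subst (λ m → m * m ≤ 2 ^ m) (m+[n∸m]≡n 4≤m) (from-4 (m ∸ 4))
  where
  open ≤-Reasoning
  -- The added term is 2m² - (m+1)² at m = 4 + j.
  expand : ∀ j → (4 + suc j) * (4 + suc j) + (j * j + 6 * j + 7) ≡ 2 * ((4 + j) * (4 + j))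
  expand = solve-∀
  from-4 : ∀ j → (4 + j) * (4 + j) ≤ 2 ^ (4 + j)
  from-4 zero = ≤-refl
  from-4 (suc j) = begin
    (4 + suc j) * (4 + suc j)                        ≤⟨ m≤m+n _ (j * j + 6 * j + 7) ⟩
    (4 + suc j) * (4 + suc j) + (j * j + 6 * j + 7)  ≡⟨ expand j ⟩
    2 * ((4 + j) * (4 + j))                          ≤⟨ *-monoʳ-≤ 2 (from-4 j) ⟩
    2 ^ (4 + suc j)                                  ∎

-- Put k = 2i: one factor 2^i absorbs the coefficient 5 + 4c = i + 1, the other absorbs i².
exponential-beats-quadratic : ∀ c → ∃[ k ] (1 + k * (c * k) < 2 ^ k)
exponential-beats-quadratic c = 2 * i , (begin-strict
  1 + 2 * i * (c * (2 * i))    ≡⟨ regroup c i ⟩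
  1 + 4 * c * (i * i)          <⟨ +-monoˡ-< (4 * c * (i * i)) 1<5i² ⟩
  5 * (i * i) + 4 * c * (i * i) ≡⟨ *-distribʳ-+ (i * i) 5 (4 * c) ⟨
  (5 + 4 * c) * (i * i)        ≤⟨ *-mono-≤ (n<b^n 2 ≤-refl i) (m²≤2^m i (m≤m+n 4 (4 * c))) ⟩
  2 ^ i * 2 ^ i                ≡⟨ ^-distribˡ-+-* 2 i i ⟨
  2 ^ (i + i)                  ≡⟨ cong (λ j → 2 ^ (i + j)) (+-identityʳ i) ⟨
  2 ^ (2 * i)                  ∎)
  where
  open ≤-Reasoning
  i = 4 + 4 * c
  regroup : ∀ c i → 1 + 2 * i * (c * (2 * i)) ≡ 1 + 4 * c * (i * i)
  regroup = solve-∀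
  1<5i² : 1 < 5 * (i * i)
  1<5i² = <-≤-trans (s≤s (s≤s z≤n)) (m≤m*n 5 (i * i))

-- The cutoff M makes the absence of RPR-primes a finite condition, which a failed bounded search
-- can establish.
module _ {p M} (pp : Prime p) (none : ∀ x → p ≤ x → x ≤ M → ¬ IsRPR x) where

  LastPrime : ℕ → ℕ → Set
  LastPrime y l = Prime l × p ≤ l × l ≤ y × (∀ q → Prime q → q ≤ y → q ≤ l)

  -- Two consecutive primes of the range enclose some 2q with q prime, as the smaller one is not RPR.
  π-last : ∀ y → p ≤ y → y ≤ M → ∃[ l ] (LastPrime y l × π y ≤ π p + π ⌊ l /2⌋)
  π-last y p≤y y≤M with m≤n⇒m<n∨m≡n p≤y
  ... | inj₂ refl = p , (pp , ≤-refl , ≤-refl , λ _ _ q≤p → q≤p) , m≤m+n (π p) _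
  π-last (suc y) _ 1+y≤M | inj₁ p<1+y with π-last y (≤-pred p<1+y) (≤-trans (n≤1+n y) 1+y≤M)
  ... | l , (pl , p≤l , l≤y , l-last) , πy≤ with prime? (suc y)
  ...   | no ¬pt = l , (pl , p≤l , m≤n⇒m≤1+n l≤y , λ q pq q≤1+y →
                     l-last q pq (≤-pred (≤∧≢⇒< q≤1+y λ { refl → ¬pt pq }))) , πy≤
  ...   | yes pt with RPR-or-image pl
  ...     | inj₁ rpr = contradiction rpr (none l p≤l (≤-trans l≤y (≤-trans (n≤1+n y) 1+y≤M)))
  ...     | inj₂ (zero , pq , _) = contradiction pq ¬prime[0]
  -- Here l/2 < q ≤ t/2 for the next prime t = `suc y`, so passing from l to t raises the count of
  -- primes up to half the last prime by at least one, matching the new prime on the left.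
  ...     | inj₂ (q@(suc q′) , pq , _ , refl) =
    suc y , (pt , <⇒≤ p<1+y , ≤-refl , λ _ _ q≤1+y → q≤1+y) , (begin
      suc (π y)                  ≤⟨ s≤s πy≤ ⟩
      suc (π p + π ⌊ l /2⌋)      ≤⟨ s≤s (+-monoʳ-≤ (π p) (π-mono ⌊l/2⌋≤q′)) ⟩
      suc (π p + π q′)           ≡⟨ +-suc (π p) (π q′) ⟨
      π p + suc (π q′)           ≡⟨ cong (π p +_) (π-prime pq) ⟨
      π p + π q                  ≤⟨ +-monoʳ-≤ (π p) (π-mono q≤⌊t/2⌋) ⟩
      π p + π ⌊ suc y /2⌋        ∎)
    where
    open ≤-Reasoning
    l-greatest : IsGreatest (PrimeBelow (2 * q)) l
    l-greatest = largestPrimeBelow-2*-isGreatest pq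
    ⌊l/2⌋≤q′ : ⌊ l /2⌋ ≤ q′
    ⌊l/2⌋≤q′ = ≤-pred (≰⇒> λ q≤⌊l/2⌋ →
      <⇒≱ (proj₂ (proj₁ l-greatest)) (≤-trans (*-monoʳ-≤ 2 q≤⌊l/2⌋) (2*⌊n/2⌋≤n l)))
    2q≤t : 2 * q ≤ suc y
    2q≤t = ≮⇒≥ λ t<2q → <⇒≱ (s≤s l≤y) (proj₂ l-greatest (suc y) (pt , t<2q))
    q≤⌊t/2⌋ : q ≤ ⌊ suc y /2⌋
    q≤⌊t/2⌋ = subst (_≤ ⌊ suc y /2⌋) (⌊2*n/2⌋≡n q) (⌊n/2⌋-mono 2q≤t)

  π-halve : ∀ y → y ≤ M → π y ≤ π p + π ⌊ y /2⌋
  π-halve y y≤M with p ≤? y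
  ... | no p≰y = ≤-trans (π-mono (<⇒≤ (≰⇒> p≰y))) (m≤m+n (π p) _)
  ... | yes p≤y with π-last y p≤y y≤M
  ...   | l , (_ , _ , l≤y , _) , πy≤ = ≤-trans πy≤ (+-monoʳ-≤ (π p) (π-mono (⌊n/2⌋-mono l≤y)))

  π[2^k]≤ : ∀ k → 2 ^ k ≤ M → π (2 ^ k) ≤ π p * k
  π[2^k]≤ zero _ = z≤n
  π[2^k]≤ (suc k) 2^≤M = begin
    π (2 ^ suc k)                ≤⟨ π-halve (2 ^ suc k) 2^≤M ⟩
    π p + π ⌊ 2 * 2 ^ k /2⌋      ≡⟨ cong (λ m → π p + π m) (⌊2*n/2⌋≡n (2 ^ k)) ⟩
    π p + π (2 ^ k)              ≤⟨ +-monoʳ-≤ (π p) (π[2^k]≤ k (≤-trans (^-monoʳ-≤ 2 (n≤1+n k)) 2^≤M)) ⟩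
    π p + π p * k                ≡⟨ *-suc (π p) k ⟨
    π p * suc k                  ∎
    where open ≤-Reasoning

-- At n + 1 = 2^k both sides of `2^n≤[n+1]^π` are powers of 2, and the exponents can be compared.
2^k≤1+k*π : ∀ k → 2 ^ k ≤ 1 + k * π (2 ^ k)
2^k≤1+k*π k = subst (_≤ 1 + k * π (2 ^ k)) 1+n≡2^k (s≤s (2^-reflects-≤ (begin
  2 ^ n                      ≤⟨ 2^n≤[n+1]^π n ⟩
  suc n ^ π (suc n)          ≡⟨ cong (λ N → N ^ π N) 1+n≡2^k ⟩
  (2 ^ k) ^ π (2 ^ k)        ≡⟨ ^-*-assoc 2 k (π (2 ^ k)) ⟩
  2 ^ (k * π (2 ^ k))        ∎)))
  where
  open ≤-Reasoning
  n = pred (2 ^ k)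
  1+n≡2^k : suc n ≡ 2 ^ k
  1+n≡2^k = suc-pred (2 ^ k) {{m^n≢0 2 k}}

-- Choose k with 1 + k(ck) < 2^k for c = π(p). Without an RPR-prime in [p, 2^k], halving gives
-- π(2^k) ≤ ck, against the lower bound `2^k≤1+k*π`.
RPR-above : ∀ {p} → Prime p → ∃[ x ] (p ≤ x × IsRPR x)
RPR-above {p} pp = search (exponential-beats-quadratic (π p))
  where
  search : ∃[ k ] (1 + k * (π p * k) < 2 ^ k) → ∃[ x ] (p ≤ x × IsRPR x)
  search (k , 1+k[ck]<2^k) with anyUpTo? (λ x → (p ≤? x) ×-dec isRPR? x) (suc (2 ^ k))
  ... | yes (x , _ , found) = x , found
  ... | no none = contradiction
    (≤-trans (2^k≤1+k*π k) (s≤s (*-monoʳ-≤ k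
      (π[2^k]≤ pp (λ x p≤x x≤2^k rpr → none (x , s≤s x≤2^k , p≤x , rpr)) k ≤-refl))))
    (<⇒≱ 1+k[ck]<2^k)

-- Enumeration of the RPR-primes

RPR-2 : IsRPR 2
RPR-2 = [ id , (λ { (q , pq , q<2 , _) → contradiction (prime>1 pq) (<⇒≱ q<2) }) ]′ (RPR-or-image prime[2])

abstract
  -- The definition of `IsRPR x` already provides a prime t > x from which `RPR-above` can start.
  -- The construction is sealed, as only leastness is used afterwards.
  nextRPR : ∀ {x} → IsRPR x → ∃[ y ] IsLeast (λ y → x < y × IsRPR y) y
  nextRPR {x} (_ , _ , _ , t , pt , x<t , _) =
    let y , t≤y , rpr = RPR-above pt
    in least (λ y → (x <? y) ×-dec isRPR? y) y (<-≤-trans x<t t≤y , rpr)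

RPRs : ℕ → ∃[ x ] IsRPR x
RPRs zero = 2 , RPR-2
RPRs (suc n) = let y , (_ , rpr) , _ = nextRPR (proj₂ (RPRs n)) in y , rpr

rpr : ℕ → ℕ
rpr n = proj₁ (RPRs n)

rpr-suc-isLeast : ∀ n → IsLeast (λ y → rpr n < y × IsRPR y) (rpr (suc n))
rpr-suc-isLeast n = proj₂ (nextRPR (proj₂ (RPRs n)))

rpr-mono-< : ∀ {m n} → m < n → rpr m < rpr n
rpr-mono-< {m} {suc n} m<1+n with m≤n⇒m<n∨m≡n (≤-pred m<1+n)
... | inj₁ m<n = <-trans (rpr-mono-< m<n) (proj₁ (proj₁ (rpr-suc-isLeast n)))
... | inj₂ refl = proj₁ (proj₁ (rpr-suc-isLeast n))

n<rpr : ∀ n → n < rpr n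
n<rpr zero = s≤s z≤n
n<rpr (suc n) = ≤-<-trans (n<rpr n) (rpr-mono-< (n<1+n n))

-- Descend from n until `rpr n` ≤ x; no RPR-prime lies strictly between consecutive values.
rpr-surjective-below : ∀ {x} → IsRPR x → ∀ n → x < rpr n → ∃[ m ] rpr m ≡ x
rpr-surjective-below (px , _) zero x<2 = contradiction (prime>1 px) (<⇒≱ x<2)
rpr-surjective-below {x} isRPR (suc n) x<rpr with <-cmp x (rpr n)
... | tri< x<rprₙ _ _ = rpr-surjective-below isRPR n x<rprₙ
... | tri≈ _ refl _ = n , refl
... | tri> _ _ rprₙ<x = contradiction (proj₂ (rpr-suc-isLeast n) x (rprₙ<x , isRPR)) (<⇒≱ x<rpr)

enumeration : ∃[ r ] IsRPREnumeration r
-- The sequence `rpr` is numbered from 0, the enumeration from 1.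
enumeration = (λ n → rpr (pred n)) ,
  (λ n _ → proj₂ (RPRs (pred n))) ,
  (λ { (suc m) (suc n) _ (s≤s m<n) → rpr-mono-< m<n }) ,
  (λ x isRPR → let m , rprₘ≡x = rpr-surjective-below isRPR x (n<rpr x) in suc m , s≤s z≤n , rprₘ≡x)

-- Blocks started at RPR-primes

∈S-start : ∀ {a} → a ∈S a
∈S-start = 1 , ≤-refl , refl

∈S-next : ∀ {a q} → q ∈S a → largestPrimeBelow (2 * q) ∈S a
∈S-next (suc j , _ , refl) = 2 + j , s≤s z≤n , refl

-- The bound a ≤ x is carried along for the minimality of block starts.
prime⇒∈S-RPR : ∀ x → Prime x → ∃[ a ] (IsRPR a × a ≤ x × x ∈S a)
prime⇒∈S-RPR = <-rec (λ x → Prime x → ∃[ a ] (IsRPR a × a ≤ x × x ∈S a)) step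
  where
  step : ∀ x → (∀ {q} → q < x → Prime q → ∃[ a ] (IsRPR a × a ≤ q × q ∈S a)) →
         Prime x → ∃[ a ] (IsRPR a × a ≤ x × x ∈S a)
  step x rec px with RPR-or-image px
  ... | inj₁ rpr = x , rpr , ≤-refl , ∈S-start
  ... | inj₂ (q , pq , q<x , refl) with rec q<x pq
  ...   | a , rpr , a≤q , q∈Sa = a , rpr , ≤-trans a≤q (<⇒≤ q<x) , ∈S-next q∈Sa

-- All later terms are images of primes, hence not RPR.
RPR∈S⇒≡start : ∀ {a x} → Prime a → IsRPR x → x ∈S a → x ≡ a
RPR∈S⇒≡start pa rpr (1 , _ , refl) = refl
RPR∈S⇒≡start pa rpr (suc (suc j) , _ , eq) = contradiction rpr (image⇒¬RPR (S-prime pa j) eq)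

-- If `r k` lay in an earlier block, it would equal that block's start, against strict monotonicity.
-- A prime y outside the blocks before k lies in some S(r n) with n ≥ k, so r k ≤ r n ≤ y.
enumeration⇒blockStarts : ∀ {r} → IsRPREnumeration r → IsBlockStartSequence r
enumeration⇒blockStarts {r} (isRPR , mono , onto) = r1≡2 , λ k 2≤k →
  let 1≤k = ≤-trans (s≤s z≤n) 2≤k in
  (proj₁ (isRPR k 1≤k) , λ { (i , 1≤i , i<k , rk∈S) →
    <-irrefl (sym (RPR∈S⇒≡start (proj₁ (isRPR i 1≤i)) (isRPR k 1≤k) rk∈S)) (mono i k 1≤i i<k) }) ,
  λ { y (py , y∉) → minimal k 1≤k y py y∉ }
  where
  mono-≤ : ∀ {m n} → 1 ≤ m → m ≤ n → r m ≤ r n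
  mono-≤ {m} {n} 1≤m m≤n with m≤n⇒m<n∨m≡n m≤n
  ... | inj₁ m<n = <⇒≤ (mono m n 1≤m m<n)
  ... | inj₂ refl = ≤-refl
  r1≡2 : r 1 ≡ 2
  r1≡2 with onto 2 RPR-2
  ... | n , 1≤n , rn≡2 = ≤-antisym (subst (r 1 ≤_) rn≡2 (mono-≤ ≤-refl 1≤n)) (prime>1 (proj₁ (isRPR 1 ≤-refl)))
  minimal : ∀ k → 1 ≤ k → ∀ y → Prime y → ¬ (∃[ i ] (1 ≤ i × i < k × y ∈S r i)) → r k ≤ y
  minimal k 1≤k y py y∉ with prime⇒∈S-RPR y py
  ... | a , rprₐ , a≤y , y∈Sa with onto a rprₐ
  ...   | n , 1≤n , refl = ≤-trans (mono-≤ 1≤k (≮⇒≥ λ n<k → y∉ (n , 1≤n , n<k , y∈Sa))) a≤y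

-- Sequences that agree before n exclude the same primes at n, so each n-th term is a candidate for
-- the other's minimum.
blockStarts-unique : ∀ {p p′} → IsBlockStartSequence p → IsBlockStartSequence p′ → ∀ n → 1 ≤ n → p n ≡ p′ n
blockStarts-unique {p} {p′} (p1≡2 , p-least) (p′1≡2 , p′-least) = <-rec (λ n → 1 ≤ n → p n ≡ p′ n) step
  where
  step : ∀ n → (∀ {m} → m < n → 1 ≤ m → p m ≡ p′ m) → 1 ≤ n → p n ≡ p′ n
  step 1 _ _ = trans p1≡2 (sym p′1≡2)
  step n@(suc (suc _)) rec _ with p-least n (s≤s (s≤s z≤n)) | p′-least n (s≤s (s≤s z≤n))
  ... | (pr , fresh) , min | (pr′ , fresh′) , min′ = ≤-antisym
    (min (p′ n) (pr′ , λ { (i , 1≤i , i<n , ∈Sᵢ) → fresh′ (i , 1≤i , i<n , subst (p′ n ∈S_) (rec i<n 1≤i) ∈Sᵢ) }))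
    (min′ (p n) (pr , λ { (i , 1≤i , i<n , ∈Sᵢ) → fresh (i , 1≤i , i<n , subst (p n ∈S_) (sym (rec i<n 1≤i)) ∈Sᵢ) }))

theorem1 : (∃[ p ] IsBlockStartSequence p) ×
    (∃[ r ] IsRPREnumeration r) ×
    (∀ (p r : ℕ → ℕ) → IsBlockStartSequence p → IsRPREnumeration r →
    ∀ n → 1 ≤ n → p n ≡ r n)
theorem1 =
  (proj₁ enumeration , enumeration⇒blockStarts (proj₂ enumeration)) ,
  enumeration ,
  -- The enumeration `r` is itself a block-start sequence, so uniqueness identifies it with `p`.
  λ p r isStart isEnum → blockStarts-unique isStart (enumeration⇒blockStarts isEnum)
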